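{- For each prime $n \geq 3$, there exists a graph $G$ such that its square $G^2$ is (isomorphic to) the complete multipartite graph $K_{n*(2n-1)}$.
   Context: Graphs are finite and simple. The square $G^2$ of a graph $G$ is the graph with $V(G^2)=V(G)$ in which two distinct vertices $x,y$ are adjacent if and only if the distance between $x$ and $y$ in $G$ is at most $2$. $K_{n*r}$ denotes the complete multipartite graph with $r$ partite sets, each of size $n$. -}

module Defs where

open import Data.Fin.Base using (Fin)
import Data.Fin.Properties as Fin
open import Data.Nat.Base using (ℕ; zero; suc; _≤_; s≤s; s≤s⁻¹; _*_)
open import Data.Nat.Properties using (anyUpTo?; allUpTo?; ≮⇒≥; <⇒≱)
open import Data.Product.Base using (∃; _×_; _,_; proj₁)
open import Function.Base using (_∘_)
open import Function.Bundles using (_↔_; _⇔_; Inverse)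
open import Function.Properties.Inverse using (↔-sym; ↔⇒↣)
open import Level using (0ℓ)
open import Relation.Binary.Core using (Rel)
open import Relation.Binary.Definitions
  using (Decidable; DecidableEquality; Irreflexive; Symmetric)
open import Relation.Binary.PropositionalEquality
  using (_≡_; _≢_; refl; sym; cong; subst)
open import Relation.Nullary.Decidable
  using (Dec; ¬?; map′; _×-dec_; via-injection)

-- Finite simple graphs. Decidability of adjacency is part of what it means,
-- constructively, for the edge set to be finite.
record Graph : Set₁ where
  field
    Vertex : Set
    order  : ℕ
    finite : Vertex ↔ Fin order
    Adj    : Rel Vertex 0ℓ
    adj?   : Decidable Adj
    symm   : Symmetric Adj
    irrefl : Irreflexive _≡_ Adj

  private module F = Inverse finite

  _≟_ : DecidableEquality Vertex
  _≟_ = via-injection (↔⇒↣ finite) Fin._≟_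

  any? : {P : Vertex → Set} → (∀ x → Dec (P x)) → Dec (∃ P)
  any? {P} P? = map′
    (λ (i , p) → F.from i , p)
    (λ (x , p) → F.to x , subst P (sym (F.strictlyInverseʳ x)) p)
    (Fin.any? (P? ∘ F.from))

module _ (G : Graph) where
  open Graph G

  data Walk : ℕ → Rel Vertex 0ℓ where
    []  : ∀ {x} → Walk 0 x x
    _∷_ : ∀ {k x y z} → Adj x y → Walk k y z → Walk (suc k) x z

  -- Distance x y d: the distance between x and y is d.  Vertices in different
  -- components are at no (finite) distance.
  Distance : Vertex → Vertex → ℕ → Set
  Distance x y d = Walk d x y × (∀ k → Walk k x y → d ≤ k)

  SquareAdj : Rel Vertex 0ℓ
  SquareAdj x y = x ≢ y × ∃ λ d → d ≤ 2 × Distance x y d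

  private
    snoc : ∀ {k x y z} → Walk k x y → Adj y z → Walk (suc k) x z
    snoc []      e = e ∷ []
    snoc (f ∷ w) e = f ∷ snoc w e

    reverse : ∀ {k x y} → Walk k x y → Walk k y x
    reverse []      = []
    reverse (e ∷ w) = snoc (reverse w) (symm e)

    walk? : ∀ k → Decidable (Walk k)
    walk? zero    x z = map′ (λ { refl → [] }) (λ { [] → refl }) (x ≟ z)
    walk? (suc k) x z = map′
      (λ (_ , e , w) → e ∷ w)
      (λ { (e ∷ w) → _ , e , w })
      (any? λ y → adj? x y ×-dec walk? k y z)

    distance? : ∀ x y d → Dec (Distance x y d)
    distance? x y d = walk? d x y ×-dec map′
      (λ none k w → ≮⇒≥ (λ k<d → none k<d w))
      (λ least {k} k<d w → <⇒≱ k<d (least k w))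
      (allUpTo? (λ k → ¬? (walk? k x y)) d)

    squareAdj? : Decidable SquareAdj
    squareAdj? x y = ¬? (x ≟ y) ×-dec map′
      (λ (d , d<3 , D) → d , s≤s⁻¹ d<3 , D)
      (λ (d , d≤2 , D) → d , s≤s d≤2 , D)
      (anyUpTo? (distance? x y) 3)

  square : Graph
  square = record
    { Vertex = Vertex
    ; order  = order
    ; finite = finite
    ; Adj    = SquareAdj
    ; adj?   = squareAdj?
    ; symm   = λ (x≢y , d , d≤2 , w , least) →
        x≢y ∘ sym , d , d≤2 , reverse w , λ k v → least k (reverse v)
    ; irrefl = λ x≡y (x≢y , _) → x≢y x≡y
    }

-- K n r has r partite sets, each of size n; the vertex (i , j) is the j-th
-- vertex of the i-th partite set.
K : ℕ → ℕ → Graph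
K n r = record
  { Vertex = Fin r × Fin n
  ; order  = r * n
  ; finite = ↔-sym Fin.*↔×
  ; Adj    = λ u v → proj₁ u ≢ proj₁ v
  ; adj?   = λ u v → ¬? (proj₁ u Fin.≟ proj₁ v)
  ; symm   = λ i≢j → i≢j ∘ sym
  ; irrefl = λ u≡v i≢j → i≢j (cong proj₁ u≡v)
  }

infix 4 _≅_

record _≅_ (G H : Graph) : Set where
  private
    module G = Graph G
    module H = Graph H
  field
    bijection : G.Vertex ↔ H.Vertex
  open Inverse bijection using (to)
  field
    adj⇔ : ∀ x y → G.Adj x y ⇔ H.Adj (to x) (to y)

{-# OPTIONS --safe #-}

-- G is built from the affine plane over ℤ/n.  Its vertices are the n² points
-- together with the n(n-1) lines of nonzero slope; a line is adjacent to its
-- points, and the points of each horizontal line form a clique.  Two points are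
-- within distance 2 exactly when they are in different columns, two lines
-- exactly when they are not parallel, and a line and a point always are, because
-- a line of nonzero slope meets every horizontal.  Hence the classes of G² are
-- the n columns and the n-1 nonzero slopes.
module Submission where

open import Defs
open import Data.Empty using (⊥; ⊥-elim)
open import Data.Fin.Base using (Fin; zero; suc; toℕ; fromℕ<)
import Data.Fin.Properties as Fin
open import Data.Integer.Base as ℤ using (ℤ; +_; -_; _-_; 0ℤ; 1ℤ)
open import Data.Integer.DivMod using (_%ℕ_; _/ℕ_; n%ℕd<d; a≡a%ℕn+[a/ℕn]*n)
open import Data.Integer.Divisibility.Signed
  using (_∣_; divides; _∣?_; ∣⇒∣ᵤ; ∣m⇒∣-m; ∣m∣n⇒∣m+n; ∣m∣n⇒∣m-n; ∣n⇒∣m*n; ∣m⇒∣m*n)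
import Data.Integer.Properties as ℤ
open import Data.Integer.Tactic.RingSolver using (solve-∀)
open import Data.Nat.Base as ℕ using (ℕ; zero; suc; _≤_; _<_; z≤n; s≤s; _*_; _∸_)
open import Data.Nat.Coprimality using (prime⇒coprime; coprime-Bézout)
import Data.Nat.Divisibility as ℕ
open import Data.Nat.GCD using (module Bézout)
open import Data.Nat.Primality using (Prime; ¬prime[0])
import Data.Nat.Properties as ℕ
open import Data.Product.Base using (∃-syntax; _×_; _,_; proj₁)
open import Data.Product.Function.NonDependent.Propositional using (_×-↔_)
open import Data.Sum.Base using (_⊎_; inj₁; inj₂)
open import Data.Sum.Properties using (inj₂-injective)
open import Function.Base using (_∘_)
open import Function.Bundles using (_⇔_; mk⇔; _↔_; Inverse; Equivalence; Injection)
open import Function.Construct.Composition using (_↔-∘_)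
open import Function.Construct.Identity using (↔-id)
open import Function.Properties.Inverse using (↔-sym; ↔⇒↣)
open import Relation.Binary.PropositionalEquality
  using (_≡_; _≢_; refl; sym; trans; cong; cong₂; subst; module ≡-Reasoning)
open import Relation.Nullary using (¬_; Dec; yes; no; ¬?; _×-dec_)

-- Adjacency in the square of a graph

module _ (G : Graph) where
  open Graph G

  squareAdj⇔ : ∀ x y →
    SquareAdj G x y ⇔ (x ≢ y × (Adj x y ⊎ ∃[ z ] Adj x z × Adj z y))
  squareAdj⇔ x y = mk⇔ to from
    where
    to : SquareAdj G x y → x ≢ y × (Adj x y ⊎ ∃[ z ] Adj x z × Adj z y)
    to (x≢y , 0 , _ , [] , _) = ⊥-elim (x≢y refl)
    to (x≢y , 1 , _ , (e ∷ []) , _) = x≢y , inj₁ e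
    to (x≢y , 2 , _ , (e ∷ (f ∷ [])) , _) = x≢y , inj₂ (_ , e , f)
    to (_ , suc (suc (suc _)) , s≤s (s≤s ()) , _)

    0<length : x ≢ y → ∀ k → Walk G k x y → 1 ≤ k
    0<length x≢y _ []      = ⊥-elim (x≢y refl)
    0<length _   _ (_ ∷ _) = s≤s z≤n

    1<length : x ≢ y → ¬ Adj x y → ∀ k → Walk G k x y → 2 ≤ k
    1<length x≢y _  _ []            = ⊥-elim (x≢y refl)
    1<length _   ¬e _ (e ∷ [])      = ⊥-elim (¬e e)
    1<length _   _  _ (_ ∷ (_ ∷ _)) = s≤s (s≤s z≤n)

    from : x ≢ y × (Adj x y ⊎ ∃[ z ] Adj x z × Adj z y) → SquareAdj G x y
    -- Vertices with a common neighbour may also be adjacent, so adjacency is decided first to know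
    -- whether the least walk length is 1 or 2.
    from (x≢y , p) with adj? x y
    ... | yes e = x≢y , 1 , s≤s z≤n , (e ∷ []) , 0<length x≢y
    from (x≢y , inj₁ e)           | no ¬e = ⊥-elim (¬e e)
    from (x≢y , inj₂ (_ , e , f)) | no ¬e =
      x≢y , 2 , ℕ.≤-refl , (e ∷ (f ∷ [])) , 1<length x≢y ¬e

-- Arithmetic modulo a prime

∣-bounded⇒≡0 : ∀ {n i} → + n ∣ i → ℤ.∣ i ∣ < n → i ≡ 0ℤ
∣-bounded⇒≡0 {n} {i} n∣i i<n with ℤ.∣ i ∣ in eq | ∣⇒∣ᵤ n∣i
... | zero  | _   = ℤ.∣i∣≡0⇒i≡0 eq
... | suc _ | n∣a = ⊥-elim (ℕ.>⇒∤ i<n n∣a)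

module AffinePlane {m : ℕ} (isPrime : Prime (suc m)) where

  p : ℕ
  p = suc m

  infix 4 _≋_
  _≋_ : ℤ → ℤ → Set
  a ≋ b = + p ∣ a - b

  ι : Fin p → ℤ
  ι x = + toℕ x

  -- With-abstraction normalises its scrutinee; without the opaque blocks that would
  -- unfold the ring-solver proofs.
  opaque
    residue : ℤ → Fin p
    residue a = fromℕ< (n%ℕd<d a p)

    residue-≋ : ∀ a → ι (residue a) ≋ a
    residue-≋ a = divides (- (a /ℕ p)) (begin
      ι (residue a) - a
        ≡⟨ cong₂ _-_ (cong +_ (Fin.toℕ-fromℕ< (n%ℕd<d a p))) (a≡a%ℕn+[a/ℕn]*n a p) ⟩
      + (a %ℕ p) - (+ (a %ℕ p) ℤ.+ (a /ℕ p) ℤ.* + p)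
        ≡⟨ ring (+ (a %ℕ p)) (a /ℕ p) (+ p) ⟩
      - (a /ℕ p) ℤ.* + p ∎)
      where
      open ≡-Reasoning
      ring : ∀ r q n → r - (r ℤ.+ q ℤ.* n) ≡ - q ℤ.* n
      ring = solve-∀

    -- Two representatives in the range from 0 to `m` differ by less than `p` in absolute value, and
    -- the only such multiple of `p` is 0.
    ι-injective : ∀ {x y} → ι x ≋ ι y → x ≡ y
    ι-injective {x} {y} x≋y = Fin.toℕ-injective (ℤ.+-injective
      (ℤ.i-j≡0⇒i≡j (ι x) (ι y) (∣-bounded⇒≡0 x≋y (ℕ.≤-<-trans
        (subst (λ i → ℤ.∣ i ∣ ≤ toℕ x ℕ.⊔ toℕ y) (sym (ℤ.m-n≡m⊖n (toℕ x) (toℕ y)))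
          (ℤ.∣m⊝n∣≤m⊔n (toℕ x) (toℕ y)))
        (ℕ.⊔-lub (Fin.toℕ<n x) (Fin.toℕ<n y))))))

    -- As `suc i` lies strictly between 0 and the prime `p`, the two are coprime and a Bézout
    -- coefficient is the inverse. Over ℕ the identity comes in two forms, which fix the sign of
    -- `e`.
    inverse : ∀ i → ∃[ e ] ι (suc i) ℤ.* e ≋ 1ℤ
    inverse i with coprime-Bézout (prime⇒coprime isPrime (Fin.toℕ<n (suc i)))
    ... | Bézout.+- x y eq = - + y , divides (- + x) (begin
        d ℤ.* - + y - 1ℤ            ≡⟨ ring d (+ y) ⟩
        - (1ℤ ℤ.+ + y ℤ.* d)        ≡⟨ cong (λ t → - (1ℤ ℤ.+ t)) (ℤ.pos-* y (suc (toℕ i))) ⟨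
        - + (1 ℕ.+ y * suc (toℕ i)) ≡⟨ cong (λ t → - + t) eq ⟩
        - + (x * p)                 ≡⟨ cong -_ (ℤ.pos-* x p) ⟩
        - (+ x ℤ.* + p)             ≡⟨ ℤ.neg-distribˡ-* (+ x) (+ p) ⟩
        - + x ℤ.* + p               ∎)
      where
      open ≡-Reasoning
      d : ℤ
      d = ι (suc i)
      ring : ∀ d y → d ℤ.* - y - 1ℤ ≡ - (1ℤ ℤ.+ y ℤ.* d)
      ring = solve-∀
    ... | Bézout.-+ x y eq = + y , divides (+ x) (begin
        d ℤ.* + y - 1ℤ            ≡⟨ cong (_- 1ℤ) (ℤ.*-comm d (+ y)) ⟩
        + y ℤ.* d - 1ℤ            ≡⟨ cong (_- 1ℤ) (ℤ.pos-* y (suc (toℕ i))) ⟨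
        + (y * suc (toℕ i)) - 1ℤ  ≡⟨ cong (λ t → + t - 1ℤ) eq ⟨
        1ℤ ℤ.+ + (x * p) - 1ℤ     ≡⟨ ring (+ (x * p)) ⟩
        + (x * p)                 ≡⟨ ℤ.pos-* x p ⟩
        + x ℤ.* + p               ∎)
      where
      open ≡-Reasoning
      d : ℤ
      d = ι (suc i)
      ring : ∀ t → 1ℤ ℤ.+ t - 1ℤ ≡ t
      ring = solve-∀

    -≋0⇒≋ : ∀ a b → a - b ≋ 0ℤ → a ≋ b
    -≋0⇒≋ a b = subst (+ p ∣_) (ℤ.+-identityʳ (a - b))

  opaque
    solveLinear : ∀ a b → ¬ a ≋ 0ℤ → ∃[ x ] a ℤ.* ι x ≋ b
    solveLinear a b a≄0 with residue a | residue-≋ a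
    ... | zero  | 0≋a = ⊥-elim (a≄0 (subst (+ p ∣_) (ring a) (∣m⇒∣-m 0≋a)))
      where
      ring : ∀ a → - (0ℤ - a) ≡ a - 0ℤ
      ring = solve-∀
    ... | suc i | r≋a with inverse i
    -- The solution is `e ℤ.* b`, reduced modulo `p`; the three divisible terms account for that
    -- reduction, for replacing `a` by its residue `r`, and for `r ℤ.* e ≋ 1ℤ`.
    ...   | e , re≋1 = x , subst (+ p ∣_) (ring a b r e (ι x))
        (∣m∣n⇒∣m+n
          (∣m∣n⇒∣m-n (∣n⇒∣m*n r (residue-≋ (e ℤ.* b))) (∣m⇒∣m*n (ι x) r≋a))
          (∣m⇒∣m*n b re≋1))
      where
      x : Fin p
      x = residue (e ℤ.* b)
      r : ℤ
      r = ι (suc i)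
      ring : ∀ a b r e x →
        r ℤ.* (x - e ℤ.* b) - (r - a) ℤ.* x ℤ.+ (r ℤ.* e - 1ℤ) ℤ.* b ≡ a ℤ.* x - b
      ring = solve-∀

  -- Incidence in the affine plane

  -- The point (k , y) lies on the line of slope i + 1 and intercept j.
  OnLine : Fin m → Fin p → Fin p → Fin p → Set
  OnLine i j k y = ι j ℤ.+ ι (suc i) ℤ.* ι k ≋ ι y

  onLine? : ∀ i j k y → Dec (OnLine i j k y)
  onLine? i j k y = + p ∣? _

  intercept-unique : ∀ {i j j′ k y} → OnLine i j k y → OnLine i j′ k y → j ≡ j′
  intercept-unique {i} {j} {j′} {k} {y} P Q = ι-injective
    (subst (+ p ∣_) (ring (ι j) (ι j′) (ι (suc i) ℤ.* ι k) (ι y)) (∣m∣n⇒∣m-n P Q))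
    where
    ring : ∀ j j′ t y → (j ℤ.+ t - y) - (j′ ℤ.+ t - y) ≡ j - j′
    ring = solve-∀

  height-unique : ∀ {i j k y y′} → OnLine i j k y → OnLine i j k y′ → y ≡ y′
  height-unique {i} {j} {k} {y} {y′} P Q = ι-injective
    (subst (+ p ∣_) (ring (ι j ℤ.+ ι (suc i) ℤ.* ι k) (ι y) (ι y′)) (∣m∣n⇒∣m-n Q P))
    where
    ring : ∀ t y y′ → (t - y′) - (t - y) ≡ y - y′
    ring = solve-∀

  opaque
    -- The slope is the quotient of the height difference by the column difference, which is
    -- invertible; the intercept is then read off at the first point.
    join : ∀ {k k′ y y′} → k ≢ k′ → y ≢ y′ →
           ∃[ i ] ∃[ j ] OnLine i j k y × OnLine i j k′ y′
    join {k} {k′} {y} {y′} k≢k′ y≢y′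
      with solveLinear (ι k - ι k′) (ι y - ι y′) (k≢k′ ∘ ι-injective ∘ -≋0⇒≋ (ι k) (ι k′))
    -- Slope 0 would put both points at the same height.
    ... | zero , S = ⊥-elim (y≢y′ (ι-injective
        (subst (+ p ∣_) (ring (ι k - ι k′) (ι y) (ι y′)) (∣m⇒∣-m S))))
      where
      ring : ∀ t y y′ → - (t ℤ.* 0ℤ - (y - y′)) ≡ y - y′
      ring = solve-∀
    ... | suc i , S = i , j
      , subst (+ p ∣_) (ring₁ (ι j) s (ι k) (ι y)) J
      , subst (+ p ∣_) (ring₂ (ι j) s (ι k) (ι k′) (ι y) (ι y′)) (∣m∣n⇒∣m-n J S)
      where
      s : ℤ
      s = ι (suc i)
      j : Fin p
      j = residue (ι y - s ℤ.* ι k)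
      J : ι j ≋ ι y - s ℤ.* ι k
      J = residue-≋ (ι y - s ℤ.* ι k)
      ring₁ : ∀ j s k y → j - (y - s ℤ.* k) ≡ j ℤ.+ s ℤ.* k - y
      ring₁ = solve-∀
      ring₂ : ∀ j s k k′ y y′ →
        (j - (y - s ℤ.* k)) - ((k - k′) ℤ.* s - (y - y′)) ≡ j ℤ.+ s ℤ.* k′ - y′
      ring₂ = solve-∀

    -- Equating the heights of the two lines gives a linear equation for the column `k`, whose
    -- coefficient is the difference of the slopes.
    meet : ∀ {i i′} j j′ → i ≢ i′ → ∃[ k ] ∃[ y ] OnLine i j k y × OnLine i′ j′ k y
    meet {i} {i′} j j′ i≢i′
      with solveLinear (ι (suc i) - ι (suc i′)) (ι j′ - ι j)
             (i≢i′ ∘ Fin.suc-injective ∘ ι-injective ∘ -≋0⇒≋ (ι (suc i)) (ι (suc i′)))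
    ... | k , S = k , y
      , subst (+ p ∣_) (ring₁ t (ι y)) Y
      , subst (+ p ∣_) (ring₂ (ι j) (ι j′) s s′ (ι k) (ι y)) (∣m∣n⇒∣m-n Y S)
      where
      s : ℤ
      s = ι (suc i)
      s′ : ℤ
      s′ = ι (suc i′)
      t : ℤ
      t = ι j ℤ.+ s ℤ.* ι k
      y : Fin p
      y = residue t
      Y : + p ∣ - (ι y - t)
      Y = ∣m⇒∣-m (residue-≋ t)
      ring₁ : ∀ t y → - (y - t) ≡ t - y
      ring₁ = solve-∀
      ring₂ : ∀ j j′ s s′ k y →
        - (y - (j ℤ.+ s ℤ.* k)) - ((s - s′) ℤ.* k - (j′ - j)) ≡ j′ ℤ.+ s′ ℤ.* k - y
      ring₂ = solve-∀

    meetHorizontal : ∀ i j y → ∃[ k ] OnLine i j k y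
    meetHorizontal i j y
      with solveLinear (ι (suc i)) (ι y - ι j) (Fin.0≢1+n ∘ sym ∘ ι-injective {suc i} {zero})
    ... | k , S = k , subst (+ p ∣_) (ring (ι (suc i) ℤ.* ι k) (ι y) (ι j)) S
      where
      ring : ∀ t y j → t - (y - j) ≡ j ℤ.+ t - y
      ring = solve-∀

  -- The graph of points and lines

  -- (inj₁ i , j) is the line of slope i + 1 and intercept j, and (inj₂ k , y) is
  -- the point of column k and height y.
  V : Set
  V = (Fin m ⊎ Fin p) × Fin p

  E : V → V → Set
  E (inj₁ _ , _) (inj₁ _  , _)  = ⊥
  E (inj₁ i , j) (inj₂ k  , y)  = OnLine i j k y
  E (inj₂ k , y) (inj₁ i  , j)  = OnLine i j k y
  E (inj₂ k , y) (inj₂ k′ , y′) = k ≢ k′ × y ≡ y′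

  -- Used both for finiteness and as the final isomorphism: it turns the class of a vertex, its
  -- first component, into the index of a partite set.
  V↔ : V ↔ (Fin (m ℕ.+ p) × Fin p)
  V↔ = ↔-sym Fin.+↔⊎ ×-↔ ↔-id _

  planeGraph : Graph
  planeGraph = record
    { Vertex = V
    ; order  = (m ℕ.+ p) * p
    ; finite = ↔-sym Fin.*↔× ↔-∘ V↔
    ; Adj    = E
    ; adj?   = adj?
    ; symm   = λ {x} {y} → symm x y
    ; irrefl = λ { {x} refl → irrefl x }
    }
    where
    adj? : ∀ x y → Dec (E x y)
    adj? (inj₁ _ , _) (inj₁ _  , _)  = no λ ()
    adj? (inj₁ i , j) (inj₂ k  , y)  = onLine? i j k y
    adj? (inj₂ k , y) (inj₁ i  , j)  = onLine? i j k y
    adj? (inj₂ k , y) (inj₂ k′ , y′) = ¬? (k Fin.≟ k′) ×-dec (y Fin.≟ y′)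

    symm : ∀ x y → E x y → E y x
    symm (inj₁ _ , _) (inj₂ _ , _) e = e
    symm (inj₂ _ , _) (inj₁ _ , _) e = e
    symm (inj₂ _ , _) (inj₂ _ , _) (k≢k′ , y≡y′) = k≢k′ ∘ sym , sym y≡y′

    irrefl : ∀ x → ¬ E x x
    irrefl (inj₂ _ , _) (k≢k , _) = k≢k refl

  -- Partite classes of the square

  E⇒classes≢ : ∀ x y → E x y → proj₁ x ≢ proj₁ y
  E⇒classes≢ (inj₁ _ , _) (inj₂ _ , _) _ ()
  E⇒classes≢ (inj₂ _ , _) (inj₁ _ , _) _ ()
  E⇒classes≢ (inj₂ _ , _) (inj₂ _ , _) (k≢k′ , _) = k≢k′ ∘ inj₂-injective

  -- Distinct parallel lines are disjoint, and a column meets each line of nonzero slope, and each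
  -- horizontal, in a single point.
  commonNeighbour⇒≡ : ∀ c a b z → E (c , a) z → E z (c , b) → a ≡ b
  commonNeighbour⇒≡ (inj₁ i) j j′ (inj₂ k , y) e f = intercept-unique {i} {k = k} {y} e f
  commonNeighbour⇒≡ (inj₂ k) y y′ (inj₁ i , j) e f = height-unique {i} {j} {k} e f
  commonNeighbour⇒≡ (inj₂ _) _ _  (inj₂ _ , _) (_ , y≡z) (_ , z≡y′) = trans y≡z z≡y′

  Within2 : V → V → Set
  Within2 x y = E x y ⊎ ∃[ z ] E x z × E z y

  -- The line meets the horizontal at height `y` in a point that either is `(k , y)` or is joined to
  -- it in the clique of that horizontal.
  line-point : ∀ i j k y → Within2 (inj₁ i , j) (inj₂ k , y)
  line-point i j k y with meetHorizontal i j y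
  ... | k′ , e with k′ Fin.≟ k
  ...   | yes refl = inj₁ e
  ...   | no k′≢k  = inj₂ ((inj₂ k′ , y) , e , k′≢k , refl)

  point-line : ∀ i j k y → Within2 (inj₂ k , y) (inj₁ i , j)
  point-line i j k y with meetHorizontal i j y
  ... | k′ , e with k Fin.≟ k′
  ...   | yes refl = inj₁ e
  ...   | no k≢k′  = inj₂ ((inj₂ k′ , y) , (k≢k′ , refl) , e)

  classes≢⇒within2 : ∀ x y → proj₁ x ≢ proj₁ y → Within2 x y
  classes≢⇒within2 (inj₁ i , j) (inj₁ i′ , j′) i≢i′ with meet j j′ (i≢i′ ∘ cong inj₁)
  ... | k , y , e , f = inj₂ ((inj₂ k , y) , e , f)
  classes≢⇒within2 (inj₁ i , j) (inj₂ k , y) _ = line-point i j k y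
  classes≢⇒within2 (inj₂ k , y) (inj₁ i , j) _ = point-line i j k y
  classes≢⇒within2 (inj₂ k , y) (inj₂ k′ , y′) k≢k′ with y Fin.≟ y′
  ... | yes y≡y′ = inj₁ (k≢k′ ∘ cong inj₂ , y≡y′)
  ... | no  y≢y′ with join (k≢k′ ∘ cong inj₂) y≢y′
  ...   | i , j , e , f = inj₂ ((inj₁ i , j) , e , f)

  squareAdj⇔classes≢ : ∀ x y → SquareAdj planeGraph x y ⇔ (proj₁ x ≢ proj₁ y)
  squareAdj⇔classes≢ x y = mk⇔ (to x y ∘ S.to)
    (λ c≢ → S.from (c≢ ∘ cong proj₁ , classes≢⇒within2 x y c≢))
    where
    module S = Equivalence (squareAdj⇔ planeGraph x y)
    to : ∀ x y → x ≢ y × Within2 x y → proj₁ x ≢ proj₁ y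
    to x       y       (_ , inj₁ e) = E⇒classes≢ x y e
    to (c , a) (_ , b) (x≢y , inj₂ (z , e , f)) refl =
      x≢y (cong (c ,_) (commonNeighbour⇒≡ c a b z e f))

  square-planeGraph : square planeGraph ≅ K p (m ℕ.+ p)
  square-planeGraph = record
    { bijection = V↔
    ; adj⇔      = λ x y → let module S = Equivalence (squareAdj⇔classes≢ x y) in
        mk⇔ (λ s → S.to s ∘ Injection.injective (↔⇒↣ (↔-sym (Fin.+↔⊎ {m} {p}))))
            (λ c≢ → S.from (c≢ ∘ cong (Inverse.from (Fin.+↔⊎ {m} {p}))))
    }

theorem2p9 : ∀ (n : ℕ) → Prime n → 3 ≤ n → ∃[ G ] square G ≅ K n (2 * n ∸ 1)
theorem2p9 zero    isPrime _ = ⊥-elim (¬prime[0] isPrime)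
theorem2p9 (suc m) isPrime _ = AffinePlane.planeGraph isPrime ,
  -- `2 * suc m ∸ 1` computes to `m ℕ.+ (suc m ℕ.+ 0)`, so only the trailing 0 has to be rewritten.
  subst (λ t → square (AffinePlane.planeGraph isPrime) ≅ K (suc m) (m ℕ.+ t))
    (sym (ℕ.+-identityʳ (suc m))) (AffinePlane.square-planeGraph isPrime)
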